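{- Let $G$ be a finite undirected multigraph without loops on $n$ vertices. Let $\Delta$ be its maximal edge multiplicity, and assume $\Delta \geqslant 1$. Let $d_1 \leqslant \dots \leqslant d_n$ be its degree sequence, and let $\tau(G)$ be the number of spanning trees of $G$. Then $$\tau(G) \leqslant \frac{(\Delta+d_1)(\Delta+d_2)\cdots(\Delta+d_n)}{\Delta\, n^2}.$$
   Context: In a multigraph, two distinct vertices may be joined by several (parallel, distinguishable) edges; the multiplicity of a pair of distinct vertices is the number of edges joining them. The maximal edge multiplicity $\Delta$ is the maximum of these multiplicities over all pairs of distinct vertices. The degree of a vertex is the number of edges incident to it, counted with multiplicity. $\tau(G)$ counts spanning trees with parallel edges regarded as distinct, i.e. it is the number of sets of edges of $G$ that form a tree on all vertices of $G$. -}

module Defs where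

open import Data.Fin using (Fin)
open import Data.Fin.Properties using (_≟_; any?; all?)
open import Data.Fin.Subset using (Subset; inside; outside; _∈_; _-_; ∣_∣)
open import Data.Fin.Subset.Properties
  using (_∈?_; nonempty?; p─q⊆p; x∈p∧x≢y⇒x∈p-y; x∈p⇒∣p-x∣<∣p∣)
import Data.List as List
open import Data.List using (List; []; _∷_; _++_; allFin; cartesianProduct; filter; length)
open import Data.List.Extrema.Nat using (max)
import Data.List.Membership.Propositional as ListMembership
open import Data.List.Membership.DecPropositional using () renaming (_∈?_ to member?)
open import Data.List.Relation.Unary.All using ([]; _∷_)
open import Data.List.Relation.Unary.All.Properties using (¬Any⇒All¬)
open import Data.List.Relation.Unary.Any using (here; there)
open import Data.List.Relation.Unary.Unique.Propositional using (Unique)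
open import Data.List.Relation.Unary.AllPairs using ([]; _∷_)
open import Data.List.Sort using (sort)
open import Data.Nat using (ℕ; zero; suc; _<_; _≥_; _*_; _^_; NonZero; >-nonZero)
open import Data.Nat.Induction using (<-wellFounded)
open import Data.Nat.Properties using (≤-decTotalOrder; m*n≢0; m^n≢0)
open import Data.Product using (∃; _×_; _,_; proj₁; proj₂)
open import Data.Product.Properties using (≡-dec)
open import Data.Sum using (_⊎_; inj₁; inj₂)
import Data.Vec as Vec
open import Induction.WellFounded using (Acc; acc)
open import Relation.Binary.PropositionalEquality using (_≡_; _≢_; refl)
open import Relation.Nullary using (¬_; Dec; yes; no; contradiction)
open import Relation.Nullary.Decidable using (map′; _×-dec_; _⊎-dec_; ¬?)

-- The endpoints of an edge are stored as an ordered pair, but the order is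
-- never used: everything below refers to them through `Joins`.
record Multigraph (n : ℕ) : Set where
  field
    #edges   : ℕ
    ends     : Fin #edges → Fin n × Fin n
    loopless : ∀ e → proj₁ (ends e) ≢ proj₂ (ends e)

  Edge : Set
  Edge = Fin #edges

  Vertex : Set
  Vertex = Fin n

module _ {n : ℕ} (G : Multigraph n) where
  open Multigraph G

  Joins : Edge → Vertex → Vertex → Set
  Joins e u v = ends e ≡ (u , v) ⊎ ends e ≡ (v , u)

  joins? : ∀ e u v → Dec (Joins e u v)
  joins? e u v = ≡-dec _≟_ _≟_ (ends e) (u , v) ⊎-dec ≡-dec _≟_ _≟_ (ends e) (v , u)

  Incident : Vertex → Edge → Set
  Incident v e = ∃ λ u → Joins e v u

  incident? : ∀ v e → Dec (Incident v e)
  incident? v e = any? (λ u → joins? e v u)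

  degree : Vertex → ℕ
  degree v = length (filter (incident? v) (allFin #edges))

  degreeSequence : List ℕ
  degreeSequence = sort ≤-decTotalOrder (List.map degree (allFin n))

  multiplicity : Vertex × Vertex → ℕ
  multiplicity (u , v) = length (filter (λ e → joins? e u v) (allFin #edges))

  distinctPairs : List (Vertex × Vertex)
  distinctPairs = filter (λ (u , v) → ¬? (u ≟ v)) (cartesianProduct (allFin n) (allFin n))

  -- The value is 0 when there are no two distinct vertices.
  Δ : ℕ
  Δ = max 0 (List.map multiplicity distinctPairs)

  data Walk (S : Subset #edges) : Vertex → Vertex → Set where
    []   : ∀ {u} → Walk S u u
    step : ∀ {u v w} (e : Edge) → e ∈ S → Joins e u v → Walk S v w → Walk S u w

  vertices : ∀ {S u v} → Walk S u v → List Vertex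
  vertices {u = u} []             = u ∷ []
  vertices {u = u} (step _ _ _ p) = u ∷ vertices p

  edges : ∀ {S u v} → Walk S u v → List Edge
  edges []             = []
  edges (step e _ _ p) = e ∷ edges p

  IsPath : ∀ {S u v} → Walk S u v → Set
  IsPath p = Unique (vertices p)

  Connected : Subset #edges → Set
  Connected S = ∀ u v → Walk S u v

  -- A cycle is a path closed up by one further edge.  Two parallel edges form
  -- a cycle; the closing edge must therefore not be an edge of the path.
  record Cycle (S : Subset #edges) : Set where
    field
      {start end} : Vertex
      path        : Walk S start end
      isPath      : IsPath path
      closing     : Edge
      closing∈S   : closing ∈ S
      joins       : Joins closing end start
      fresh       : closing ListMembership.∉ edges path

  Acyclic : Subset #edges → Set
  Acyclic S = ¬ Cycle S

  IsSpanningTree : Subset #edges → Set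
  IsSpanningTree S = Connected S × Acyclic S

  mapWalk : ∀ {S T u v} (p : Walk S u v) →
            (∀ {e} → e ListMembership.∈ edges p → e ∈ S → e ∈ T) → Walk T u v
  mapWalk []               f = []
  mapWalk (step e e∈S j p) f = step e (f (here refl) e∈S) j (mapWalk p (λ i → f (there i)))

  edges-mapWalk : ∀ {S T u v} (p : Walk S u v)
                  (f : ∀ {e} → e ListMembership.∈ edges p → e ∈ S → e ∈ T) →
                  edges (mapWalk p f) ≡ edges p
  edges-mapWalk []             f = refl
  edges-mapWalk (step e _ _ p) f rewrite edges-mapWalk p (λ i → f (there i)) = refl

  vertices-mapWalk : ∀ {S T u v} (p : Walk S u v)
                     (f : ∀ {e} → e ListMembership.∈ edges p → e ∈ S → e ∈ T) →
                     vertices (mapWalk p f) ≡ vertices p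
  vertices-mapWalk []             f = refl
  vertices-mapWalk (step e _ _ p) f rewrite vertices-mapWalk p (λ i → f (there i)) = refl

  edges⊆ : ∀ {S u v e} (p : Walk S u v) → e ListMembership.∈ edges p → e ∈ S
  edges⊆ (step _ e∈S _ p) (here refl) = e∈S
  edges⊆ (step _ _ _ p)   (there i)   = edges⊆ p i

  _++ʷ_ : ∀ {S u v w} → Walk S u v → Walk S v w → Walk S u w
  []             ++ʷ q = q
  step e e∈S j p ++ʷ q = step e e∈S j (p ++ʷ q)

  x∉p-x : ∀ {m} (p : Subset m) (x : Fin m) → ¬ x ∈ p - x
  x∉p-x (_ Vec.∷ p) Fin.zero    ()
  x∉p-x (_ Vec.∷ p) (Fin.suc x) (Vec.there i) = x∉p-x p x i

  Path : Subset #edges → Vertex → Vertex → Set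
  Path S u v = ∃ λ (p : Walk S u v) → IsPath p

  suffix : ∀ {S u v w} (p : Walk S u w) → IsPath p →
           v ListMembership.∈ vertices p → Path S v w
  suffix []               d       (here refl) = [] , d
  suffix (step e e∈S j p) d       (here refl) = step e e∈S j p , d
  suffix (step e e∈S j p) (_ ∷ d) (there i)   = suffix p d i

  toPath : ∀ {S u v} → Walk S u v → Path S u v
  toPath []                       = [] , [] ∷ []
  toPath {u = u} (step e e∈S j p) with toPath p
  ... | q , d with member? _≟_ u (vertices q)
  ...   | yes i = suffix q d i
  ...   | no ¬i = step e e∈S j q , ¬Any⇒All¬ _ ¬i ∷ d

  -- Removing e from S: a walk either avoids e or can be rerouted to cross e once.
  Detour : Subset #edges → Edge → Vertex → Vertex → Set
  Detour S e u v = let (x , y) = ends e in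
    Walk (S - e) u v ⊎
    (Walk (S - e) u x × Walk (S - e) y v) ⊎
    (Walk (S - e) u y × Walk (S - e) x v)

  toDetour : ∀ {S u v} e → Walk S u v → Detour S e u v
  toDetour e [] = inj₁ []
  toDetour {S} {u} {v} e (step e′ e′∈S j p) with e′ ≟ e | toDetour e p
  ... | no e′≢e | inj₁ q              = inj₁ (step e′ (x∈p∧x≢y⇒x∈p-y e′∈S e′≢e) j q)
  ... | no e′≢e | inj₂ (inj₁ (q , r)) = inj₂ (inj₁ (step e′ (x∈p∧x≢y⇒x∈p-y e′∈S e′≢e) j q , r))
  ... | no e′≢e | inj₂ (inj₂ (q , r)) = inj₂ (inj₂ (step e′ (x∈p∧x≢y⇒x∈p-y e′∈S e′≢e) j q , r))
  ... | yes refl | d with j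
  ...   | inj₁ eq rewrite eq = case₁ d
    where
    case₁ : ∀ {x y} → (Walk (S - e) y v ⊎ (Walk (S - e) y x × Walk (S - e) y v) ⊎
                       (Walk (S - e) y y × Walk (S - e) x v)) →
            Walk (S - e) x v ⊎ (Walk (S - e) x x × Walk (S - e) y v) ⊎
            (Walk (S - e) x y × Walk (S - e) x v)
    case₁ (inj₁ q)              = inj₂ (inj₁ ([] , q))
    case₁ (inj₂ (inj₁ (_ , q))) = inj₂ (inj₁ ([] , q))
    case₁ (inj₂ (inj₂ (_ , q))) = inj₁ q
  ...   | inj₂ eq rewrite eq = case₂ d
    where
    case₂ : ∀ {x y} → (Walk (S - e) x v ⊎ (Walk (S - e) x x × Walk (S - e) y v) ⊎
                       (Walk (S - e) x y × Walk (S - e) x v)) →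
            Walk (S - e) y v ⊎ (Walk (S - e) y x × Walk (S - e) y v) ⊎
            (Walk (S - e) y y × Walk (S - e) x v)
    case₂ (inj₁ q)              = inj₂ (inj₂ ([] , q))
    case₂ (inj₂ (inj₁ (_ , q))) = inj₁ q
    case₂ (inj₂ (inj₂ (_ , q))) = inj₂ (inj₂ ([] , q))

  widen : ∀ {S u v} e → Walk (S - e) u v → Walk S u v
  widen e p = mapWalk p (λ _ → p─q⊆p _ _)

  fromDetour : ∀ {S u v} e → e ∈ S → Detour S e u v → Walk S u v
  fromDetour e e∈S (inj₁ p)              = widen e p
  fromDetour e e∈S (inj₂ (inj₁ (p , q))) = widen e p ++ʷ step e e∈S (inj₁ refl) (widen e q)
  fromDetour e e∈S (inj₂ (inj₂ (p , q))) = widen e p ++ʷ step e e∈S (inj₂ refl) (widen e q)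

  walkAcc? : ∀ S → Acc _<_ ∣ S ∣ → ∀ u v → Dec (Walk S u v)
  walkAcc? S (acc rs) u v with nonempty? S
  ... | no ∅ = map′ (λ { refl → [] })
                    (λ { [] → refl ; (step e e∈S _ _) → contradiction (e , e∈S) ∅ })
                    (u ≟ v)
  ... | yes (e , e∈S) = map′ (fromDetour e e∈S) (toDetour e)
        (rec? u v ⊎-dec ((rec? u x ×-dec rec? y v) ⊎-dec (rec? u y ×-dec rec? x v)))
    where
    x = proj₁ (ends e)
    y = proj₂ (ends e)
    rec? : ∀ u v → Dec (Walk (S - e) u v)
    rec? = walkAcc? (S - e) (rs (x∈p⇒∣p-x∣<∣p∣ e∈S))

  walk? : ∀ S u v → Dec (Walk S u v)
  walk? S = walkAcc? S (<-wellFounded ∣ S ∣)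

  cycle? : ∀ S → Dec (Cycle S)
  cycle? S = map′ to from
    (any? λ e → any? λ u → any? λ v → e ∈? S ×-dec joins? e v u ×-dec walk? (S - e) u v)
    where
    to : (∃ λ e → ∃ λ u → ∃ λ v → e ∈ S × Joins e v u × Walk (S - e) u v) → Cycle S
    to (e , u , v , e∈S , j , w) with toPath w
    ... | p , d = record
      { path      = widen e p
      ; isPath    = isPath′
      ; closing   = e
      ; closing∈S = e∈S
      ; joins     = j
      ; fresh     = fresh′
      }
      where
      isPath′ : IsPath (widen {S} e p)
      isPath′ rewrite vertices-mapWalk {T = S} p (λ _ → p─q⊆p _ _) = d
      fresh′ : e ListMembership.∉ edges (widen {S} e p)
      fresh′ i rewrite edges-mapWalk {T = S} p (λ _ → p─q⊆p _ _) = x∉p-x S e (edges⊆ p i)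
    from : Cycle S → ∃ λ e → ∃ λ u → ∃ λ v → e ∈ S × Joins e v u × Walk (S - e) u v
    from c = closing , _ , _ , closing∈S , joins ,
             mapWalk path (λ i e∈S → x∈p∧x≢y⇒x∈p-y e∈S (λ { refl → fresh i }))
      where open Cycle c

  isSpanningTree? : ∀ S → Dec (IsSpanningTree S)
  isSpanningTree? S = (all? λ u → all? λ v → walk? S u v) ×-dec ¬? (cycle? S)

-- All subsets of Fin m, each listed exactly once.
subsets : ∀ m → List (Subset m)
subsets zero    = Vec.[] ∷ []
subsets (suc m) = List.map (outside Vec.∷_) (subsets m) ++ List.map (inside Vec.∷_) (subsets m)

τ : ∀ {n} → Multigraph n → ℕ
τ G = length (filter (isSpanningTree? G) (subsets (Multigraph.#edges G)))

denominator≢0 : ∀ {n} (G : Multigraph n) → Δ G ≥ 1 → NonZero (Δ G * n ^ 2)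
denominator≢0 {zero}  G ()
denominator≢0 {suc n} G Δ≥1 = m*n≢0 (Δ G) (suc n ^ 2) {{>-nonZero Δ≥1}} {{m^n≢0 (suc n) 2}}

{-# OPTIONS --safe #-}
-- Adjoin to the signed incidence row s v of each vertex v a coordinate with
-- entry 1 and weight Δ, so that the row r v has square length Δ + d v.  Let ω be
-- the exterior product of all rows r v.  Hadamard's inequality bounds the square
-- length of ω by the product of the Δ + d v.  On the other hand the rows s v sum
-- to zero, so r 0 may be replaced in ω by n times the new basis vector; hence
-- |ω|² ≥ Δ n² |σ|², where σ is the product of the s v with v ≠ 0.  The coefficient
-- of σ at a spanning tree T is a nonzero integer: pairing σ with the product of
-- the chains of the walks in T from vertex 0 gives 1, and only T contributes to
-- the pairing.  Therefore |σ|² ≥ τ(G).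
module Submission where

open import Defs

open import Data.Bool.Base using (if_then_else_)
open import Data.Fin.Base using (Fin; zero; suc)
open import Data.Fin.Properties using (_≟_; any?; suc-injective)
open import Data.Fin.Subset as Subset using (Subset; Side; inside; outside; _∈_; _∉_; _⊆_; ∣_∣)
open import Data.Fin.Subset.Properties using (_∈?_; x∈p∧x≢y⇒x∈p-y; p⊂q⇒∣p∣<∣q∣; ⊆-antisym)
import Data.Integer.Base as ℤ
import Data.Integer.Properties as ℤ
open import Data.Integer.Tactic.RingSolver using (solve-∀)
open import Data.List.Base using ([]; _∷_; tabulate; filter; length; allFin)
open import Data.List.Membership.Propositional using () renaming (_∈_ to _∈ˡ_)
open import Data.List.Properties using (filter-++; length-++; map-tabulate)
open import Data.List.Relation.Binary.Permutation.Propositional.Properties using (map⁺)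
open import Data.List.Relation.Unary.Unique.Propositional using (Unique)
open import Data.List.Sort using (sort-↭)
import Data.Nat.Base as ℕ
open import Data.Nat.ListAction.Properties using (product-↭)
import Data.Nat.Properties as ℕ
open import Data.Product.Base using (proj₁; proj₂; _,_)
import Data.Rational.Base as ℚ
import Data.Rational.Properties as ℚ
open import Data.Rational.Unnormalised.Base using (mkℚᵘ; *≤*)
import Data.Rational.Unnormalised.Properties as ℚᵘ
open import Data.Sum.Base using (_⊎_; inj₁; inj₂; [_,_]′)
open import Data.Vec.Base using ([]; _∷_; here; there)
open import Data.Vec.Functional using (Vector; head; tail)
open import Function.Base using (_∘_; const; id)
open import Relation.Binary.PropositionalEquality
open import Relation.Nullary using (¬_; Dec; yes; no; does; contradiction)
open import Relation.Nullary.Decidable using (_×-dec_; ¬?; decidable-stable; dec-true; dec-false)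
open import Relation.Unary using (Pred; Decidable)
open import Data.Nat using (ℕ; zero; suc; _≥_)
open import Data.Integer using (+_)
open import Data.Rational using (_/_)
open import Data.List using (map)
open import Data.Nat.ListAction using (product)

-- Exterior algebra with an orthogonal basis of weighted vectors.

module ExteriorAlgebra where
  open import Algebra.Properties.Semiring.Sum ℤ.+-*-semiring using (sum)
  open import Data.Integer.Base
    using (ℤ; 0ℤ; 1ℤ; -1ℤ; _+_; _*_; _-_; -_; -[1+_]; _≤_; +≤+; nonNegative)

  private variable
    m p : ℕ

  -- ω S is the coefficient of the product, in increasing order, of the basis
  -- vectors e k with k ∈ S.
  Form : ℕ → Set
  Form m = Subset m → ℤ

  _↾_ : Form (suc m) → Side → Form m
  (ω ↾ s) S = ω (s ∷ S)

  unit : Form m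
  unit []            = 1ℤ
  unit (outside ∷ S) = unit S
  unit (inside ∷ S)  = 0ℤ

  -- Left multiplication by `r`, splitting off the first basis vector. In the `inside` clause
  -- `tail r` has to pass that basis vector, hence the minus sign.
  wedge : Vector ℤ m → Form m → Form m
  wedge r ω []            = 0ℤ
  wedge r ω (outside ∷ S) = wedge (tail r) (ω ↾ outside) S
  wedge r ω (inside ∷ S)  = head r * ω (outside ∷ S) - wedge (tail r) (ω ↾ inside) S

  -- The adjoint of wedge r for the inner product in which the basis vectors are
  -- orthogonal and e k has square length q k.
  contract : Vector ℤ m → Vector ℤ m → Form m → Form m
  contract q r ω []            = 0ℤ
  contract q r ω (outside ∷ S) =
    contract (tail q) (tail r) (ω ↾ outside) S + head q * head r * ω (inside ∷ S)
  contract q r ω (inside ∷ S)  = - contract (tail q) (tail r) (ω ↾ inside) S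

  dot : Vector ℤ m → Vector ℤ m → Vector ℤ m → ℤ
  dot q r s = sum (λ k → q k * (r k * s k))

  inner : Vector ℤ m → Form m → Form m → ℤ
  inner {zero}  q ω η = ω [] * η []
  inner {suc m} q ω η =
    inner (tail q) (ω ↾ outside) (η ↾ outside) + head q * inner (tail q) (ω ↾ inside) (η ↾ inside)

  normSq : Vector ℤ m → Form m → ℤ
  normSq q ω = inner q ω ω

  wedges : (Fin p → Vector ℤ m) → Form m
  wedges {zero}  f = unit
  wedges {suc p} f = wedge (head f) (wedges (tail f))

  -- Linearity of product, contraction and inner product.

  minus-linear : ∀ a x y → a * x - y ≡ a * x + -1ℤ * y
  minus-linear = solve-∀

  plus-linear : ∀ a x y → x + a * y ≡ 1ℤ * x + a * y
  plus-linear = solve-∀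

  neg-linear : ∀ x y → - x ≡ -1ℤ * x + 0ℤ * y
  neg-linear = solve-∀

  -- The combination enters through a pointwise equation for `ζ`, so forms that agree only pointwise
  -- can be used without function extensionality.
  wedge-linear : ∀ r {ζ ω η : Form m} a b → (∀ S → ζ S ≡ a * ω S + b * η S) →
                 ∀ S → wedge r ζ S ≡ a * wedge r ω S + b * wedge r η S
  wedge-linear r a b eq []            = sym (cong₂ _+_ (ℤ.*-zeroʳ a) (ℤ.*-zeroʳ b))
  wedge-linear r a b eq (outside ∷ S) = wedge-linear (tail r) a b (eq ∘ (outside ∷_)) S
  wedge-linear r {ω = ω} {η} a b eq (inside ∷ S)
    rewrite eq (outside ∷ S)
          | wedge-linear (tail r) {ω = ω ↾ inside} {η ↾ inside} a b (eq ∘ (inside ∷_)) S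
    = lemma (head r) a b _ _ _ _
    where
    lemma : ∀ r a b x y z w → r * (a * x + b * y) - (a * z + b * w) ≡ a * (r * x - z) + b * (r * y - w)
    lemma = solve-∀

  contract-linear : ∀ q r {ζ ω η : Form m} a b → (∀ S → ζ S ≡ a * ω S + b * η S) →
                    ∀ S → contract q r ζ S ≡ a * contract q r ω S + b * contract q r η S
  contract-linear q r a b eq [] = sym (cong₂ _+_ (ℤ.*-zeroʳ a) (ℤ.*-zeroʳ b))
  contract-linear q r {ω = ω} {η} a b eq (outside ∷ S)
    rewrite eq (inside ∷ S)
          | contract-linear (tail q) (tail r) {ω = ω ↾ outside} {η ↾ outside} a b (eq ∘ (outside ∷_)) S
    = lemma (head q) (head r) a b _ _ _ _
    where
    lemma : ∀ q r a b x y z w → a * z + b * w + q * r * (a * x + b * y) ≡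
                                a * (z + q * r * x) + b * (w + q * r * y)
    lemma = solve-∀
  contract-linear q r {ω = ω} {η} a b eq (inside ∷ S)
    rewrite contract-linear (tail q) (tail r) {ω = ω ↾ inside} {η ↾ inside} a b (eq ∘ (inside ∷_)) S
    = lemma a b _ _
    where
    lemma : ∀ a b z w → - (a * z + b * w) ≡ a * - z + b * - w
    lemma = solve-∀

  inner-comm : ∀ q (ω η : Form m) → inner q ω η ≡ inner q η ω
  inner-comm {zero}  q ω η = ℤ.*-comm (ω []) (η [])
  inner-comm {suc m} q ω η = cong₂ (λ x y → x + head q * y)
    (inner-comm (tail q) (ω ↾ outside) (η ↾ outside)) (inner-comm (tail q) (ω ↾ inside) (η ↾ inside))

  inner-linear : ∀ q {ξ ζ ω η : Form m} a b → (∀ S → ζ S ≡ a * ω S + b * η S) →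
                 inner q ξ ζ ≡ a * inner q ξ ω + b * inner q ξ η
  inner-linear {zero} q {ξ} a b eq rewrite eq [] = lemma a b (ξ []) _ _
    where
    lemma : ∀ a b x y z → x * (a * y + b * z) ≡ a * (x * y) + b * (x * z)
    lemma = solve-∀
  inner-linear {suc m} q {ξ} {ζ} {ω} {η} a b eq
    rewrite inner-linear (tail q) {ξ ↾ outside} {ζ ↾ outside} {ω ↾ outside} {η ↾ outside} a b (eq ∘ (outside ∷_))
          | inner-linear (tail q) {ξ ↾ inside} {ζ ↾ inside} {ω ↾ inside} {η ↾ inside} a b (eq ∘ (inside ∷_))
    = lemma (head q) a b _ _ _ _
    where
    lemma : ∀ q a b x y z w → a * x + b * y + q * (a * z + b * w) ≡ a * (x + q * z) + b * (y + q * w)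
    lemma = solve-∀

  normSq-scale : ∀ q a {ζ ω : Form m} → (∀ S → ζ S ≡ a * ω S) → normSq q ζ ≡ a * a * normSq q ω
  normSq-scale q a {ζ} {ω} eq = begin
    normSq q ζ              ≡⟨ scale ζ ⟩
    a * inner q ζ ω       ≡⟨ cong (a *_) (inner-comm q ζ ω) ⟩
    a * inner q ω ζ       ≡⟨ cong (a *_) (scale ω) ⟩
    a * (a * normSq q ω)    ≡⟨ ℤ.*-assoc a a _ ⟨
    a * a * normSq q ω      ∎
    where
    open ≡-Reasoning
    scale : ∀ ξ → inner q ξ ζ ≡ a * inner q ξ ω
    scale ξ = trans (inner-linear q {ξ} {ζ} {ω} {ω} a 0ℤ
                      (λ S → trans (eq S) (sym (ℤ.+-identityʳ _))))
                    (ℤ.+-identityʳ _)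

  -- Adjointness, anticommutation and Hadamard's inequality.

  inner-wedge : ∀ q r (ω η : Form m) → inner q (wedge r ω) η ≡ inner q ω (contract q r η)
  inner-wedge {zero}  q r ω η = sym (ℤ.*-zeroʳ (ω []))
  inner-wedge {suc m} q r ω η = begin
      ⟪ wedge (tail r) ω₀ , η₀ ⟫ + head q * ⟪ wedge r ω ↾ inside , η₁ ⟫
    ≡⟨ cong (λ x → ⟪ wedge (tail r) ω₀ , η₀ ⟫ + head q * x)
         (trans (inner-comm (tail q) (wedge r ω ↾ inside) η₁)
                (inner-linear (tail q) (head r) -1ℤ (λ S → minus-linear (head r) (ω₀ S) _))) ⟩
      ⟪ wedge (tail r) ω₀ , η₀ ⟫ + head q * (head r * ⟪ η₁ , ω₀ ⟫ + -1ℤ * ⟪ η₁ , wedge (tail r) ω₁ ⟫)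
    ≡⟨ cong₂ (λ x y → x + head q * y) (inner-wedge (tail q) (tail r) ω₀ η₀)
         (cong₂ (λ x y → head r * x + -1ℤ * y) (inner-comm (tail q) η₁ ω₀)
           (trans (inner-comm (tail q) η₁ (wedge (tail r) ω₁)) (inner-wedge (tail q) (tail r) ω₁ η₁))) ⟩
      ⟪ ω₀ , ι η₀ ⟫ + head q * (head r * ⟪ ω₀ , η₁ ⟫ + -1ℤ * ⟪ ω₁ , ι η₁ ⟫)
    ≡⟨ lemma (head q) (head r) ⟪ ω₀ , ι η₀ ⟫ ⟪ ω₀ , η₁ ⟫ ⟪ ω₁ , ι η₁ ⟫ ⟩
      (1ℤ * ⟪ ω₀ , ι η₀ ⟫ + head q * head r * ⟪ ω₀ , η₁ ⟫)
        + head q * (-1ℤ * ⟪ ω₁ , ι η₁ ⟫ + 0ℤ * ⟪ ω₁ , ι η₁ ⟫)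
    ≡⟨ cong₂ (λ x y → x + head q * y)
         (inner-linear (tail q) {ω₀} {contract q r η ↾ outside} {ι η₀} {η₁} 1ℤ (head q * head r)
           (λ S → plus-linear (head q * head r) (ι η₀ S) (η₁ S)))
         (inner-linear (tail q) {ω₁} {contract q r η ↾ inside} {ι η₁} {ι η₁} -1ℤ 0ℤ
           (λ S → neg-linear _ (ι η₁ S))) ⟨
      ⟪ ω₀ , contract q r η ↾ outside ⟫ + head q * ⟪ ω₁ , contract q r η ↾ inside ⟫
    ∎
    where
    open ≡-Reasoning
    ω₀ = ω ↾ outside
    ω₁ = ω ↾ inside
    η₀ = η ↾ outside
    η₁ = η ↾ inside
    ι  = contract (tail q) (tail r)
    ⟪_,_⟫ = inner (tail q)
    lemma : ∀ q r x y z → x + q * (r * y + -1ℤ * z) ≡ (1ℤ * x + q * r * y) + q * (-1ℤ * z + 0ℤ * z)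
    lemma = solve-∀

  -- Contraction is an antiderivation, which is the anticommutation relation of the Clifford
  -- algebra. Induction on the coordinates reduces it to ring identities.
  contract-wedge : ∀ q r s (ω : Form m) S →
                   contract q r (wedge s ω) S ≡ dot q r s * ω S + -1ℤ * wedge s (contract q r ω) S
  contract-wedge q r s ω [] = refl
  contract-wedge q r s ω (outside ∷ S)
    rewrite contract-wedge (tail q) (tail r) (tail s) (ω ↾ outside) S
          | wedge-linear (tail s) {contract q r ω ↾ outside} {contract (tail q) (tail r) (ω ↾ outside)} {ω ↾ inside}
              1ℤ (head q * head r)
              (λ S → plus-linear (head q * head r) (contract (tail q) (tail r) (ω ↾ outside) S) (ω (inside ∷ S))) S
    = lemma (head q) (head r) (head s) (dot (tail q) (tail r) (tail s)) _ _ _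
    where
    lemma : ∀ q r s d x w₀ w₁ → d * x + -1ℤ * w₀ + q * r * (s * x - w₁) ≡
                                (q * (r * s) + d) * x + -1ℤ * (1ℤ * w₀ + q * r * w₁)
    lemma = solve-∀
  contract-wedge q r s ω (inside ∷ S)
    rewrite contract-linear (tail q) (tail r) {wedge s ω ↾ inside} {ω ↾ outside} {wedge (tail s) (ω ↾ inside)}
              (head s) -1ℤ (λ S → minus-linear (head s) _ _) S
          | contract-wedge (tail q) (tail r) (tail s) (ω ↾ inside) S
          | wedge-linear (tail s) {contract q r ω ↾ inside} {contract (tail q) (tail r) (ω ↾ inside)} {const 0ℤ}
              -1ℤ 0ℤ (λ S → neg-linear _ 0ℤ) S
    = lemma (head q) (head r) (head s) (dot (tail q) (tail r) (tail s)) _ _ _ 0ℤ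
    where
    lemma : ∀ q r s d x c w z → - (s * c + -1ℤ * (d * x + -1ℤ * w)) ≡
               (q * (r * s) + d) * x + -1ℤ * (s * (c + q * r * x) - (-1ℤ * w + 0ℤ * z))
    lemma = solve-∀

  -- Pair `contract-wedge` for `s = r` with `ω`. Adjointness turns both products of a multiplication
  -- and a contraction into square lengths.
  normSq-wedge : ∀ q r (ω : Form m) →
               normSq q (wedge r ω) + normSq q (contract q r ω) ≡ dot q r r * normSq q ω
  normSq-wedge q r ω = begin
      normSq q (wedge r ω) + normSq q (contract q r ω)
    ≡⟨ cong₂ _+_ (inner-wedge q r ω (wedge r ω)) (sym (inner-wedge q r (contract q r ω) ω)) ⟩
      inner q ω (contract q r (wedge r ω)) + inner q (wedge r (contract q r ω)) ω
    ≡⟨ cong₂ _+_ (inner-linear q (dot q r r) -1ℤ (contract-wedge q r r ω)) (inner-comm q _ ω) ⟩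
      dot q r r * normSq q ω + -1ℤ * inner q ω (wedge r (contract q r ω)) + inner q ω (wedge r (contract q r ω))
    ≡⟨ lemma (dot q r r * normSq q ω) _ ⟩
      dot q r r * normSq q ω
    ∎
    where
    open ≡-Reasoning
    lemma : ∀ x y → x + -1ℤ * y + y ≡ x
    lemma = solve-∀

  square-nonneg : ∀ i → 0ℤ ≤ i * i
  square-nonneg (+ n)         = subst (0ℤ ≤_) (ℤ.pos-* n n) (+≤+ ℕ.z≤n)
  square-nonneg -[1+ n ]  = +≤+ ℕ.z≤n

  inner-zero : ∀ q {ω η : Form m} → (∀ S → ω S * η S ≡ 0ℤ) → inner q ω η ≡ 0ℤ
  inner-zero {zero}  q eq = eq []
  inner-zero {suc m} q {ω} {η} eq
    rewrite inner-zero (tail q) {ω ↾ outside} {η ↾ outside} (eq ∘ (outside ∷_))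
          | inner-zero (tail q) {ω ↾ inside} {η ↾ inside} (eq ∘ (inside ∷_))
    = trans (ℤ.+-identityˡ _) (ℤ.*-zeroʳ (head q))

  normSq-nonneg : ∀ {q} → (∀ k → 0ℤ ≤ q k) → (ω : Form m) → 0ℤ ≤ normSq q ω
  normSq-nonneg {zero}  q≥0 ω = square-nonneg (ω [])
  normSq-nonneg {suc m} {q} q≥0 ω = ℤ.+-mono-≤ (normSq-nonneg (q≥0 ∘ suc) (ω ↾ outside))
    (subst (_≤ head q * normSq (tail q) (ω ↾ inside)) (ℤ.*-zeroʳ (head q))
      (ℤ.*-monoˡ-≤-nonNeg (head q) {{nonNegative (q≥0 zero)}} (normSq-nonneg (q≥0 ∘ suc) (ω ↾ inside))))

  normSq-unit : ∀ (q : Vector ℤ m) → normSq q unit ≡ 1ℤ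
  normSq-unit {zero}  q = refl
  normSq-unit {suc m} q
    rewrite normSq-unit (tail q) | inner-zero (tail q) {const 0ℤ} {const 0ℤ} (λ _ → refl)
    = cong (λ x → 1ℤ + x) (ℤ.*-zeroʳ (head q))

  -- By `normSq-wedge`, multiplication by a vector enlarges the square length at most by the square
  -- length of that vector, since the contraction term is nonnegative.
  hadamard : ∀ {q : Vector ℤ m} → (∀ k → 0ℤ ≤ q k) →
             (f : Fin p → Vector ℤ m) (c : Fin p → ℕ) → (∀ i → dot q (f i) (f i) ≡ + c i) →
             normSq q (wedges f) ≤ + product (tabulate c)
  hadamard {p = zero}  {q} q≥0 f c eq = ℤ.≤-reflexive (normSq-unit q)
  hadamard {p = suc p} {q} q≥0 f c eq = begin
    normSq q (wedge (head f) ω)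
      ≤⟨ ℤ.i≤i+j _ (normSq q (contract q (head f) ω))
           {{nonNegative (normSq-nonneg q≥0 (contract q (head f) ω))}} ⟩
    normSq q (wedge (head f) ω) + normSq q (contract q (head f) ω)
      ≡⟨ normSq-wedge q (head f) ω ⟩
    dot q (head f) (head f) * normSq q ω
      ≡⟨ cong (_* normSq q ω) (eq zero) ⟩
    + head c * normSq q ω
      ≤⟨ ℤ.*-monoˡ-≤-nonNeg (+ head c) (hadamard q≥0 (tail f) (tail c) (eq ∘ suc)) ⟩
    + head c * + product (tabulate (tail c))
      ≡⟨ ℤ.pos-* (head c) _ ⟨
    + product (tabulate c) ∎
    where
    open ℤ.≤-Reasoning
    ω = wedges (tail f)

  -- Alternation and row operations.

  wedge-cong : ∀ r {ω η : Form m} → (∀ S → ω S ≡ η S) → ∀ S → wedge r ω S ≡ wedge r η S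
  wedge-cong r eq []            = refl
  wedge-cong r eq (outside ∷ S) = wedge-cong (tail r) (eq ∘ (outside ∷_)) S
  wedge-cong r eq (inside ∷ S)  =
    cong₂ (λ x y → head r * x - y) (eq (outside ∷ S)) (wedge-cong (tail r) (eq ∘ (inside ∷_)) S)

  wedge-zero : ∀ r {ω : Form m} → (∀ S → ω S ≡ 0ℤ) → ∀ S → wedge r ω S ≡ 0ℤ
  -- `0ℤ * x + 0ℤ * y` computes to `0ℤ`, so `eq` already is the required linear relation.
  wedge-zero r {ω} eq = wedge-linear r {ω} {ω} {ω} 0ℤ 0ℤ eq

  contract-zero : ∀ q r {ω : Form m} → (∀ S → ω S ≡ 0ℤ) → ∀ S → contract q r ω S ≡ 0ℤ
  contract-zero q r {ω} eq = contract-linear q r {ω} {ω} {ω} 0ℤ 0ℤ eq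

  wedge-+ : ∀ {r s t} → (∀ k → r k ≡ s k + t k) → ∀ (ω : Form m) S →
            wedge r ω S ≡ wedge s ω S + wedge t ω S
  wedge-+ eq ω []            = refl
  wedge-+ eq ω (outside ∷ S) = wedge-+ (eq ∘ suc) (ω ↾ outside) S
  wedge-+ {s = s} {t} eq ω (inside ∷ S) rewrite eq zero | wedge-+ (eq ∘ suc) (ω ↾ inside) S =
    lemma (head s) (head t) _ _ _
    where
    lemma : ∀ s t x y z → (s + t) * x - (y + z) ≡ (s * x - y) + (t * x - z)
    lemma = solve-∀

  zero-wedge : ∀ {r} → (∀ k → r k ≡ 0ℤ) → ∀ (ω : Form m) S → wedge r ω S ≡ 0ℤ
  zero-wedge eq ω []            = refl
  zero-wedge eq ω (outside ∷ S) = zero-wedge (eq ∘ suc) (ω ↾ outside) S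
  zero-wedge eq ω (inside ∷ S) rewrite eq zero | zero-wedge (eq ∘ suc) (ω ↾ inside) S = refl

  wedge-anticomm : ∀ r s (ω : Form m) S → wedge r (wedge s ω) S ≡ - wedge s (wedge r ω) S
  wedge-anticomm r s ω []            = refl
  wedge-anticomm r s ω (outside ∷ S) = wedge-anticomm (tail r) (tail s) (ω ↾ outside) S
  wedge-anticomm r s ω (inside ∷ S)
    rewrite wedge-linear (tail r) {wedge s ω ↾ inside} (head s) -1ℤ
              (λ S → minus-linear (head s) (ω (outside ∷ S)) _) S
          | wedge-linear (tail s) {wedge r ω ↾ inside} (head r) -1ℤ
              (λ S → minus-linear (head r) (ω (outside ∷ S)) _) S
          | wedge-anticomm (tail r) (tail s) (ω ↾ inside) S
    = lemma (head r) (head s) _ _ _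
    where
    lemma : ∀ r s x y z → r * x - (s * y + -1ℤ * - z) ≡ - (s * y - (r * x + -1ℤ * z))
    lemma = solve-∀

  -- Proved directly by cancellation: `wedge-anticomm` with equal vectors gives only that the value
  -- is its own negative.
  wedge-self : ∀ r (ω : Form m) S → wedge r (wedge r ω) S ≡ 0ℤ
  wedge-self r ω []            = refl
  wedge-self r ω (outside ∷ S) = wedge-self (tail r) (ω ↾ outside) S
  wedge-self r ω (inside ∷ S)
    rewrite wedge-linear (tail r) {wedge r ω ↾ inside} (head r) -1ℤ
              (λ S → minus-linear (head r) (ω (outside ∷ S)) _) S
          | wedge-self (tail r) (ω ↾ inside) S
    = lemma (head r) _
    where
    lemma : ∀ r x → r * x - (r * x + -1ℤ * 0ℤ) ≡ 0ℤ
    lemma = solve-∀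

  -- Move the extra factor past the earlier ones, up to sign, until it meets its copy.
  wedge-repeated : ∀ (f : Fin p → Vector ℤ m) i S → wedge (f i) (wedges f) S ≡ 0ℤ
  wedge-repeated f zero    S = wedge-self (head f) (wedges (tail f)) S
  wedge-repeated f (suc i) S = trans (wedge-anticomm (f (suc i)) (head f) (wedges (tail f)) S)
    (cong -_ (wedge-zero (head f) (wedge-repeated (tail f) i) S))

  sum-wedge-zero : ∀ (f : Fin p → Vector ℤ m) {ω} → (∀ i S → wedge (f i) ω S ≡ 0ℤ) →
                   ∀ S → wedge (λ k → sum (λ i → f i k)) ω S ≡ 0ℤ
  sum-wedge-zero {zero}  f {ω} eq S = zero-wedge (λ _ → refl) ω S
  sum-wedge-zero {suc p} f {ω} eq S = trans (wedge-+ {s = head f} (λ _ → refl) ω S)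
    (cong₂ _+_ (eq zero S) (sum-wedge-zero (tail f) (eq ∘ suc) S))

  -- Adding the other rows to the first one changes nothing, because each of them already occurs in
  -- the product.
  wedges-sum : ∀ (f : Fin (suc p) → Vector ℤ m) S →
               wedges f S ≡ wedge (λ k → sum (λ i → f i k)) (wedges (tail f)) S
  wedges-sum f S = sym (trans (wedge-+ {s = head f} (λ _ → refl) (wedges (tail f)) S)
    (trans (cong (λ x → wedges f S + x) (sum-wedge-zero (tail f) (wedge-repeated (tail f)) S)) (ℤ.+-identityʳ _)))

  -- Sets without the first basis vector only see the projection that forgets it, and this
  -- projection respects products.
  wedges-outside : ∀ (f : Fin p → Vector ℤ (suc m)) S → wedges f (outside ∷ S) ≡ wedges (tail ∘ f) S
  wedges-outside {zero}  f S = refl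
  wedges-outside {suc p} f S = wedge-cong (tail (head f)) (wedges-outside (tail f)) S

  -- Pairing of products of dual families.

  contract-unit : ∀ q r (S : Subset m) → contract q r unit S ≡ 0ℤ
  contract-unit q r []            = refl
  contract-unit q r (outside ∷ S) = cong₂ _+_ (contract-unit (tail q) (tail r) S) (ℤ.*-zeroʳ (head q * head r))
  contract-unit q r (inside ∷ S)  = cong -_ (contract-zero (tail q) (tail r) (λ _ → refl) S)

  contract-wedges : ∀ q r (f : Fin p → Vector ℤ m) → (∀ i → dot q r (f i) ≡ 0ℤ) →
                    ∀ S → contract q r (wedges f) S ≡ 0ℤ
  contract-wedges {zero}  q r f eq S = contract-unit q r S
  contract-wedges {suc p} q r f eq S
    rewrite contract-wedge q r (head f) (wedges (tail f)) S
          | eq zero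
          | wedge-zero (head f) (contract-wedges q r (tail f) (eq ∘ suc)) S
    = refl

  -- A special case of the Gram determinant, with the identity as Gram matrix. Contracting the
  -- second product with `head f` removes `head g` and kills the rest, as `head f` is orthogonal to
  -- the later factors.
  inner-dual : ∀ q (f g : Fin p → Vector ℤ m) →
               (∀ i → dot q (f i) (g i) ≡ 1ℤ) → (∀ {i j} → i ≢ j → dot q (f i) (g j) ≡ 0ℤ) →
               inner q (wedges f) (wedges g) ≡ 1ℤ
  inner-dual {zero}  q f g diag off = normSq-unit q
  inner-dual {suc p} q f g diag off = begin
      inner q (wedge (head f) F) (wedge (head g) G)
    ≡⟨ inner-wedge q (head f) F _ ⟩
      inner q F (contract q (head f) (wedge (head g) G))
    ≡⟨ inner-linear q {F} {η = const 0ℤ} 1ℤ -1ℤ contracted ⟩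
      1ℤ * inner q F G + -1ℤ * inner q F (const 0ℤ)
    ≡⟨ cong₂ (λ x y → 1ℤ * x + -1ℤ * y)
         (inner-dual q (tail f) (tail g) (diag ∘ suc) (λ i≢j → off (i≢j ∘ suc-injective)))
         (inner-zero q {F} {const 0ℤ} (λ S → ℤ.*-zeroʳ (F S))) ⟩
      1ℤ
    ∎
    where
    open ≡-Reasoning
    F = wedges (tail f)
    G = wedges (tail g)
    contracted : ∀ S → contract q (head f) (wedge (head g) G) S ≡ 1ℤ * G S + -1ℤ * 0ℤ
    contracted S
      rewrite contract-wedge q (head f) (head g) G S
            | diag zero
            | wedge-zero (head g) (contract-wedges q (head f) (tail g) (λ j → off {zero} {suc j} λ ())) S
      = refl

  -- Degree and support of a product.

  wedge-degree : ∀ r {ω : Form m} j k → (∀ S → j ℕ.+ ∣ S ∣ ≢ k → ω S ≡ 0ℤ) →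
                 ∀ S → j ℕ.+ ∣ S ∣ ≢ suc k → wedge r ω S ≡ 0ℤ
  wedge-degree r j k eq []            ≢ = refl
  wedge-degree r j k eq (outside ∷ S) ≢ = wedge-degree (tail r) j k (eq ∘ (outside ∷_)) S ≢
  wedge-degree r {ω} j k eq (inside ∷ S) ≢
    rewrite ℕ.+-suc j ∣ S ∣
          | eq (outside ∷ S) (≢ ∘ cong suc)
          -- The offset `j` counts the elements of the set that the recursion has already split off.
          | wedge-degree (tail r) {ω ↾ inside} (suc j) k
              (λ S′ ≢′ → eq (inside ∷ S′) (≢′ ∘ trans (sym (ℕ.+-suc j ∣ S′ ∣)))) S ≢
    = cong (_- 0ℤ) (ℤ.*-zeroʳ (head r))

  unit-degree : ∀ (S : Subset m) → ∣ S ∣ ≢ 0 → unit S ≡ 0ℤ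
  unit-degree []            ≢ = contradiction refl ≢
  unit-degree (outside ∷ S) ≢ = unit-degree S ≢
  unit-degree (inside ∷ S)  ≢ = refl

  wedges-degree : ∀ (f : Fin p → Vector ℤ m) S → ∣ S ∣ ≢ p → wedges f S ≡ 0ℤ
  wedges-degree {zero}  f = unit-degree
  wedges-degree {suc p} f = wedge-degree (head f) 0 p (wedges-degree (tail f))

  wedge-support : ∀ {r k} {ω : Form m} → r k ≡ 0ℤ → (∀ S → k ∈ S → ω S ≡ 0ℤ) →
                  ∀ S → k ∈ S → wedge r ω S ≡ 0ℤ
  wedge-support {r = r} {zero} {ω} r≡0 eq (inside ∷ S) here
    rewrite r≡0 | wedge-zero (tail r) {ω ↾ inside} (λ S → eq (inside ∷ S) here) S = refl
  wedge-support r≡0 eq (outside ∷ S) (there k∈S) =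
    wedge-support r≡0 (λ S k∈S → eq (outside ∷ S) (there k∈S)) S k∈S
  wedge-support {r = r} {ω = ω} r≡0 eq (inside ∷ S) (there k∈S)
    rewrite eq (outside ∷ S) (there k∈S)
          | wedge-support {r = tail r} {ω = ω ↾ inside} r≡0 (λ S k∈S → eq (inside ∷ S) (there k∈S)) S k∈S
    = cong (_- 0ℤ) (ℤ.*-zeroʳ (head r))

  unit-support : ∀ {k} (S : Subset m) → k ∈ S → unit S ≡ 0ℤ
  unit-support (inside ∷ S)  here        = refl
  unit-support (outside ∷ S) (there k∈S) = unit-support S k∈S
  unit-support (inside ∷ S)  (there k∈S) = refl

  wedges-support : ∀ (f : Fin p → Vector ℤ m) {k} → (∀ i → f i k ≡ 0ℤ) →
                   ∀ S → k ∈ S → wedges f S ≡ 0ℤ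
  wedges-support {zero}  f eq S k∈S = unit-support S k∈S
  wedges-support {suc p} f eq S k∈S = wedge-support (eq zero) (wedges-support (tail f) (eq ∘ suc)) S k∈S

  -- Counting nonzero coefficients.

  length-filter-map : ∀ {a b p} {A : Set a} {B : Set b} {P : Pred B p} (P? : Decidable P) (f : A → B) xs →
                      length (filter P? (map f xs)) ≡ length (filter (P? ∘ f) xs)
  length-filter-map P? f []       = refl
  length-filter-map P? f (x ∷ xs) with P? (f x)
  ... | yes _ = cong suc (length-filter-map P? f xs)
  ... | no  _ = length-filter-map P? f xs

  square-≥1 : ∀ {i} → i ≢ 0ℤ → 1ℤ ≤ i * i
  square-≥1 {+ zero}     i≢0 = contradiction refl i≢0
  square-≥1 {+ (suc n)}  i≢0 = +≤+ (ℕ.s≤s ℕ.z≤n)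
  square-≥1 { -[1+ n ]}  i≢0 = +≤+ (ℕ.s≤s ℕ.z≤n)

  -- The coefficients are integers, so each counted set adds at least 1 to the square length. The
  -- recursion follows that of `subsets`.
  count-≤-normSq : ∀ {a} {P : Pred (Subset m) a} (P? : Decidable P) (ω : Form m) →
                 (∀ S → P S → ω S ≢ 0ℤ) →
                 + length (filter P? (subsets m)) ≤ normSq (const 1ℤ) ω
  count-≤-normSq {zero} P? ω ω≢0 with P? []
  ... | yes p = square-≥1 (ω≢0 [] p)
  ... | no  _ = square-nonneg (ω [])
  count-≤-normSq {suc m} P? ω ω≢0
    rewrite filter-++ P? (map (outside ∷_) (subsets m)) (map (inside ∷_) (subsets m))
          | length-++ (filter P? (map (outside ∷_) (subsets m))) {filter P? (map (inside ∷_) (subsets m))}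
          | length-filter-map P? (outside ∷_) (subsets m)
          | length-filter-map P? (inside ∷_) (subsets m)
          | ℤ.*-identityˡ (normSq (const 1ℤ) (ω ↾ inside))
    = ℤ.+-mono-≤ (count-≤-normSq (P? ∘ (outside ∷_)) (ω ↾ outside) (ω≢0 ∘ (outside ∷_)))
                 (count-≤-normSq (P? ∘ (inside ∷_)) (ω ↾ inside) (ω≢0 ∘ (inside ∷_)))

-- Indicators and finite sums.

module IncidenceRows where
  open import Algebra.Properties.Semiring.Sum ℤ.+-*-semiring
    using (sum; sum-cong-≗; sum-replicate-zero; ∑-distrib-+; ∑-comm)
  open import Data.Integer.Base
    using (ℤ; 0ℤ; 1ℤ; _+_; _*_; _-_; -_; _≤_; +≤+; nonNegative)
  open ExteriorAlgebra

  ⟦_⟧ : ∀ {a} {A : Set a} → Dec A → ℤ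
  ⟦ d ⟧ = if does d then 1ℤ else 0ℤ

  ⟦⟧-true : ∀ {a} {A : Set a} (d : Dec A) → A → ⟦ d ⟧ ≡ 1ℤ
  ⟦⟧-true d a rewrite dec-true d a = refl

  ⟦⟧-false : ∀ {a} {A : Set a} (d : Dec A) → ¬ A → ⟦ d ⟧ ≡ 0ℤ
  ⟦⟧-false d ¬a rewrite dec-false d ¬a = refl

  ⟦⟧-cong : ∀ {a b} {A : Set a} {B : Set b} (d : Dec A) (e : Dec B) → (A → B) → (B → A) → ⟦ d ⟧ ≡ ⟦ e ⟧
  ⟦⟧-cong (yes a) e to from = sym (⟦⟧-true e (to a))
  ⟦⟧-cong (no ¬a) e to from = sym (⟦⟧-false e (¬a ∘ from))

  -- The difference is 1, -1 or 0. It is applied with the vertex being the head or the tail of an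
  -- edge, and `C` being incidence.
  ⟦⟧-difference-square : ∀ {a b c} {A : Set a} {B : Set b} {C : Set c} (d : Dec A) (e : Dec B) (f : Dec C) →
                         (A → ¬ B) → (A → C) → (B → C) → (C → A ⊎ B) →
                         (⟦ d ⟧ - ⟦ e ⟧) * (⟦ d ⟧ - ⟦ e ⟧) ≡ ⟦ f ⟧
  ⟦⟧-difference-square (yes a) (yes b) f excl l r cover = contradiction b (excl a)
  ⟦⟧-difference-square (yes a) (no _)  f excl l r cover = sym (⟦⟧-true f (l a))
  ⟦⟧-difference-square (no _)  (yes b) f excl l r cover = sym (⟦⟧-true f (r b))
  ⟦⟧-difference-square (no ¬a) (no ¬b) f excl l r cover = sym (⟦⟧-false f ([ ¬a , ¬b ]′ ∘ cover))

  sum-zero : ∀ {n} {f : Vector ℤ n} → (∀ i → f i ≡ 0ℤ) → sum f ≡ 0ℤ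
  sum-zero {n} eq = trans (sum-cong-≗ eq) (sum-replicate-zero n)

  sum-one : ∀ n → sum {n} (const 1ℤ) ≡ + n
  sum-one zero    = refl
  sum-one (suc n) = cong (λ x → 1ℤ + x) (sum-one n)

  sum-⟦≟⟧ : ∀ {n} (g : Vector ℤ n) i → sum (λ j → g j * ⟦ i ≟ j ⟧) ≡ g i
  sum-⟦≟⟧ g zero    = trans (cong₂ _+_ (ℤ.*-identityʳ (head g)) (sum-zero (λ j → ℤ.*-zeroʳ (g (suc j)))))
                            (ℤ.+-identityʳ (head g))
  sum-⟦≟⟧ g (suc i) = trans (cong₂ _+_ (ℤ.*-zeroʳ (head g)) (sum-⟦≟⟧ (tail g) i)) (ℤ.+-identityˡ _)

  sum-⟦∈?⟧ : ∀ {n} (S : Subset n) → sum (λ k → ⟦ k ∈? S ⟧) ≡ + ∣ S ∣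
  sum-⟦∈?⟧ []            = refl
  sum-⟦∈?⟧ (outside ∷ S) = trans (ℤ.+-identityˡ _) (sum-⟦∈?⟧ S)
  sum-⟦∈?⟧ (inside ∷ S)  = cong (λ x → 1ℤ + x) (sum-⟦∈?⟧ S)

  sum-⟦filter⟧ : ∀ {a p n} {A : Set a} {P : Pred A p} (P? : Decidable P) (f : Fin n → A) →
                 sum (λ i → ⟦ P? (f i) ⟧) ≡ + length (filter P? (tabulate f))
  sum-⟦filter⟧ {n = zero}  P? f = refl
  sum-⟦filter⟧ {n = suc n} P? f with P? (f zero)
  ... | yes _ = cong (λ x → 1ℤ + x) (sum-⟦filter⟧ P? (f ∘ suc))
  ... | no  _ = trans (ℤ.+-identityˡ _) (sum-⟦filter⟧ P? (f ∘ suc))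

  ⊆∧∣∣≡⇒≡ : ∀ {n} {S T : Subset n} → S ⊆ T → ∣ S ∣ ≡ ∣ T ∣ → S ≡ T
  ⊆∧∣∣≡⇒≡ {S = S} S⊆T eq = ⊆-antisym S⊆T λ {k} k∈T → decidable-stable (k ∈? S)
    λ k∉S → ℕ.<-irrefl eq (p⊂q⇒∣p∣<∣q∣ (S⊆T , k , k∈T , k∉S))

  dot-one : ∀ {m} (r s : Vector ℤ m) → dot (const 1ℤ) r s ≡ sum (λ k → r k * s k)
  dot-one r s = sum-cong-≗ (λ k → ℤ.*-identityˡ (r k * s k))

  -- Coboundaries, chains and fundamental cuts.

  module _ {n : ℕ} (G : Multigraph n) where
    open Multigraph G

    -- The stored order of the endpoints serves as an orientation, from the first to the second.
    coboundary : (Vertex → ℤ) → Vector ℤ #edges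
    coboundary f e = f (proj₂ (ends e)) - f (proj₁ (ends e))

    incidence : Vertex → Vector ℤ #edges
    incidence v = coboundary (λ w → ⟦ w ≟ v ⟧)

    -- Counts signed traversals: `inj₁` is a step along the orientation, `inj₂` a step against it.
    chain : ∀ {S u v} → Walk G S u v → Vector ℤ #edges
    chain []                    k = 0ℤ
    chain (step e _ (inj₁ _) w) k = ⟦ e ≟ k ⟧ + chain w k
    chain (step e _ (inj₂ _) w) k = - ⟦ e ≟ k ⟧ + chain w k

    -- Each step contributes the change of `f` along it, whichever way the edge is oriented, and
    -- these changes telescope.
    stokes : ∀ f {S u v} (w : Walk G S u v) → sum (λ k → coboundary f k * chain w k) ≡ f v - f u
    stokes f {u = u} [] = trans (sum-zero (λ k → ℤ.*-zeroʳ (coboundary f k))) (sym (ℤ.+-inverseʳ (f u)))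
    stokes f {u = u} {v} (step {v = x} e _ (inj₁ eq) w) = begin
        sum (λ k → coboundary f k * (⟦ e ≟ k ⟧ + chain w k))
      ≡⟨ sum-cong-≗ (λ k → ℤ.*-distribˡ-+ (coboundary f k) ⟦ e ≟ k ⟧ (chain w k)) ⟩
        sum (λ k → coboundary f k * ⟦ e ≟ k ⟧ + coboundary f k * chain w k)
      ≡⟨ ∑-distrib-+ (λ k → coboundary f k * ⟦ e ≟ k ⟧) _ ⟩
        sum (λ k → coboundary f k * ⟦ e ≟ k ⟧) + sum (λ k → coboundary f k * chain w k)
      ≡⟨ cong₂ _+_ (sum-⟦≟⟧ (coboundary f) e) (stokes f w) ⟩
        coboundary f e + (f v - f x)
      ≡⟨ cong (λ (a , b) → f b - f a + (f v - f x)) eq ⟩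
        f x - f u + (f v - f x)
      ≡⟨ telescope (f u) (f x) (f v) ⟩
        f v - f u
      ∎
      where
      open ≡-Reasoning
      telescope : ∀ x y z → y - x + (z - y) ≡ z - x
      telescope = solve-∀
    stokes f {u = u} {v} (step {v = x} e _ (inj₂ eq) w) = begin
        sum (λ k → coboundary f k * (- ⟦ e ≟ k ⟧ + chain w k))
      ≡⟨ sum-cong-≗ (λ k → distrib (coboundary f k) ⟦ e ≟ k ⟧ (chain w k)) ⟩
        sum (λ k → - coboundary f k * ⟦ e ≟ k ⟧ + coboundary f k * chain w k)
      ≡⟨ ∑-distrib-+ (λ k → - coboundary f k * ⟦ e ≟ k ⟧) _ ⟩
        sum (λ k → - coboundary f k * ⟦ e ≟ k ⟧) + sum (λ k → coboundary f k * chain w k)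
      ≡⟨ cong₂ _+_ (sum-⟦≟⟧ (-_ ∘ coboundary f) e) (stokes f w) ⟩
        - coboundary f e + (f v - f x)
      ≡⟨ cong (λ (a , b) → - (f b - f a) + (f v - f x)) eq ⟩
        - (f u - f x) + (f v - f x)
      ≡⟨ telescope (f u) (f x) (f v) ⟩
        f v - f u
      ∎
      where
      open ≡-Reasoning
      distrib : ∀ a b c → a * (- b + c) ≡ - a * b + a * c
      distrib = solve-∀
      telescope : ∀ x y z → - (x - y) + (z - y) ≡ z - x
      telescope = solve-∀

    chain-support : ∀ {S u v k} (w : Walk G S u v) → k ∉ S → chain w k ≡ 0ℤ
    chain-support []                        k∉S = refl
    chain-support {k = k} (step e e∈S (inj₁ _) w) k∉S
      rewrite ⟦⟧-false (e ≟ k) (λ { refl → k∉S e∈S }) | chain-support w k∉S = refl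
    chain-support {k = k} (step e e∈S (inj₂ _) w) k∉S
      rewrite ⟦⟧-false (e ≟ k) (λ { refl → k∉S e∈S }) | chain-support w k∉S = refl

    -- The coboundary is linear and the rows `incidence v` are its values on the vertex indicators,
    -- in which `g` is expanded.
    sum-incidence : ∀ g k → sum (λ v → incidence v k * g v) ≡ coboundary g k
    sum-incidence g k = begin
        sum (λ v → (⟦ y ≟ v ⟧ - ⟦ x ≟ v ⟧) * g v)
      ≡⟨ sum-cong-≗ (λ v → distrib ⟦ y ≟ v ⟧ ⟦ x ≟ v ⟧ (g v)) ⟩
        sum (λ v → g v * ⟦ y ≟ v ⟧ + - g v * ⟦ x ≟ v ⟧)
      ≡⟨ ∑-distrib-+ (λ v → g v * ⟦ y ≟ v ⟧) _ ⟩
        sum (λ v → g v * ⟦ y ≟ v ⟧) + sum (λ v → - g v * ⟦ x ≟ v ⟧)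
      ≡⟨ cong₂ _+_ (sum-⟦≟⟧ g y) (sum-⟦≟⟧ (-_ ∘ g) x) ⟩
        coboundary g k
      ∎
      where
      open ≡-Reasoning
      x = proj₁ (ends k)
      y = proj₂ (ends k)
      distrib : ∀ a b c → (a - b) * c ≡ c * a + - c * b
      distrib = solve-∀

    incidence-square : ∀ v k → incidence v k * incidence v k ≡ ⟦ incident? G v k ⟧
    incidence-square v k = ⟦⟧-difference-square (y ≟ v) (x ≟ v) (incident? G v k)
      -- Without loops, no edge has both its ends at `v`.
      (λ y≡v x≡v → loopless k (trans x≡v (sym y≡v)))
      (λ { refl → x , inj₂ refl })
      (λ { refl → y , inj₁ refl })
      (λ { (_ , inj₁ eq) → inj₂ (cong proj₁ eq) ; (_ , inj₂ eq) → inj₁ (cong proj₂ eq) })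
      where
      x = proj₁ (ends k)
      y = proj₂ (ends k)

    dot-incidence : ∀ v → dot (const 1ℤ) (incidence v) (incidence v) ≡ + degree G v
    dot-incidence v = trans (dot-one (incidence v) (incidence v))
      (trans (sum-cong-≗ (incidence-square v)) (sum-⟦filter⟧ (incident? G v) (λ k → k)))

    closeCycle : ∀ {S e} → e ∈ S → Walk G (S Subset.- e) (proj₂ (ends e)) (proj₁ (ends e)) → Cycle G S
    closeCycle {S} {e} e∈S w = record
      { path      = widen G e p
      ; isPath    = subst Unique (sym (vertices-mapWalk G {T = S} p _)) isPath
      ; closing   = e
      ; closing∈S = e∈S
      ; joins     = inj₁ refl
      ; fresh     = λ i → x∉p-x G S e (edges⊆ G p (subst (e ∈ˡ_) (edges-mapWalk G {T = S} p _) i))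
      }
      where
      p = proj₁ (toPath G w)
      isPath = proj₂ (toPath G w)

    module _ {T} (acyclic : Acyclic G T) {e} (e∈T : e ∈ T) where

      -- The side of the fundamental cut of e that contains the head of e.
      cut : Vertex → ℤ
      cut v = ⟦ walk? G (T Subset.- e) (proj₂ (ends e)) v ⟧

      -- The head of `e` is on its own side; a walk from there to the tail that avoids `e` would
      -- close up to a cycle.
      coboundary-cut : coboundary cut e ≡ 1ℤ
      coboundary-cut = cong₂ _-_ (⟦⟧-true (walk? G _ _ _) []) (⟦⟧-false (walk? G _ _ _) (acyclic ∘ closeCycle e∈T))

      -- Such an edge survives in `T - e`, so a walk reaching one of its ends extends to the other.
      coboundary-cut-other : ∀ {k} → k ∈ T → k ≢ e → coboundary cut k ≡ 0ℤ
      coboundary-cut-other k∈T k≢e = ℤ.i≡j⇒i-j≡0 (⟦⟧-cong (walk? G _ _ _) (walk? G _ _ _)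
        (λ w → _++ʷ_ G w (step _ k∈T-e (inj₂ refl) [])) (λ w → _++ʷ_ G w (step _ k∈T-e (inj₁ refl) [])))
        where
        k∈T-e = x∈p∧x≢y⇒x∈p-y k∈T k≢e

      -- Stokes for the indicator of the cut: `e` is the only edge of `T` across the cut, and the
      -- chain vanishes off `T`.
      chain≡cut : ∀ {u v} (w : Walk G T u v) → chain w e ≡ cut v - cut u
      chain≡cut w = trans (sym (trans (sum-cong-≗ only-e) (sum-⟦≟⟧ (chain w) e))) (stokes cut w)
        where
        only-e : ∀ k → coboundary cut k * chain w k ≡ chain w k * ⟦ e ≟ k ⟧
        only-e k with e ≟ k | k ∈? T
        ... | yes refl | _       = trans (cong (_* chain w e) coboundary-cut) (ℤ.*-comm 1ℤ (chain w e))
        ... | no e≢k   | yes k∈T = trans (cong (_* chain w k) (coboundary-cut-other k∈T (e≢k ∘ sym)))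
                                         (ℤ.*-comm 0ℤ (chain w k))
        ... | no _     | no k∉T  rewrite chain-support w k∉T = ℤ.*-zeroʳ (coboundary cut k)

  -- Spanning trees and the coefficients of the reduced incidence rows.

  module _ {p : ℕ} (G : Multigraph (suc p)) where
    open Multigraph G

    reducedIncidence : Fin p → Vector ℤ #edges
    reducedIncidence i = incidence G (suc i)

    module _ {T} (spanning : IsSpanningTree G T) where
      private
        connected = proj₁ spanning
        acyclic   = proj₂ spanning

      rootChain : Vertex → Vector ℤ #edges
      rootChain v = chain G (connected zero v)

      dot-rootChain : ∀ v u → dot (const 1ℤ) (incidence G v) (rootChain u) ≡ ⟦ u ≟ v ⟧ - ⟦ zero ≟ v ⟧
      dot-rootChain v u = trans (dot-one (incidence G v) (rootChain u))
                                (stokes G (λ w → ⟦ w ≟ v ⟧) (connected zero u))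

      -- On `T`, `chain≡cut` applies to both root chains and the value of the cut at the root
      -- cancels; off `T` both chains vanish.
      coboundary-rootChain : ∀ k → coboundary G (λ v → rootChain v k) k ≡ ⟦ k ∈? T ⟧
      coboundary-rootChain k with k ∈? T
      ... | no k∉T  = cong₂ _-_ (chain-support G (connected zero _) k∉T) (chain-support G (connected zero _) k∉T)
      ... | yes k∈T = begin
          rootChain y k - rootChain x k
        ≡⟨ cong₂ _-_ (chain≡cut G acyclic k∈T (connected zero y)) (chain≡cut G acyclic k∈T (connected zero x)) ⟩
          (χ y - χ zero) - (χ x - χ zero)
        ≡⟨ cancel (χ y) (χ x) (χ zero) ⟩
          χ y - χ x
        ≡⟨ coboundary-cut G acyclic k∈T ⟩
          1ℤ
        ∎
        where
        open ≡-Reasoning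
        x = proj₁ (ends k)
        y = proj₂ (ends k)
        χ = cut G acyclic k∈T
        cancel : ∀ a b c → (a - c) - (b - c) ≡ a - b
        cancel = solve-∀

      -- Both sides are the trace of the product of the incidence matrix and the
      -- matrix of root chains.
      spanningTree-size : ∣ T ∣ ≡ p
      spanningTree-size = ℤ.+-injective (begin
          + ∣ T ∣
        ≡⟨ sum-⟦∈?⟧ T ⟨
          sum (λ k → ⟦ k ∈? T ⟧)
        ≡⟨ sum-cong-≗ (λ k → trans (sum-incidence G (λ v → rootChain v k) k) (coboundary-rootChain k)) ⟨
          sum (λ k → sum (λ v → incidence G v k * rootChain v k))
        ≡⟨ ∑-comm (λ v k → incidence G v k * rootChain v k) ⟨
          sum (λ v → sum (λ k → incidence G v k * rootChain v k))
        ≡⟨ sum-cong-≗ {suc p} (λ v → trans (sym (dot-one (incidence G v) (rootChain v))) (dot-rootChain v v)) ⟩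
          sum {suc p} (λ v → ⟦ v ≟ v ⟧ - ⟦ zero ≟ v ⟧)
        -- The summand of the root is 1 - 1, so only the other `p` vertices count.
        ≡⟨ ℤ.+-identityˡ _ ⟩
          sum {p} (λ i → ⟦ suc i ≟ suc i ⟧ - 0ℤ)
        ≡⟨ sum-cong-≗ {p} (λ i → cong (_- 0ℤ) (⟦⟧-true (suc i ≟ suc i) refl)) ⟩
          sum {p} (const 1ℤ)
        ≡⟨ sum-one p ⟩
          + p
        ∎)
        where open ≡-Reasoning

      -- If the coefficient were zero, the pairing with the root chains would vanish, though
      -- `inner-dual` makes it 1. A set of the wrong size is killed by the incidence rows and one
      -- not inside `T` by the root chains; what remains is `T`, by `spanningTree-size`.
      spanningTree-coefficient : wedges reducedIncidence T ≢ 0ℤ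
      spanningTree-coefficient T≡0 =
        contradiction (trans (sym (inner-dual (const 1ℤ) reducedIncidence (rootChain ∘ suc) diagonal off-diagonal))
                             (inner-zero (const 1ℤ) vanish)) λ ()
        where
        diagonal : ∀ i → dot (const 1ℤ) (reducedIncidence i) (rootChain (suc i)) ≡ 1ℤ
        diagonal i = trans (dot-rootChain (suc i) (suc i)) (cong (_- 0ℤ) (⟦⟧-true (suc i ≟ suc i) refl))
        off-diagonal : ∀ {i j} → i ≢ j → dot (const 1ℤ) (reducedIncidence i) (rootChain (suc j)) ≡ 0ℤ
        off-diagonal {i} {j} i≢j = trans (dot-rootChain (suc i) (suc j))
          (cong (_- 0ℤ) (⟦⟧-false (suc j ≟ suc i) λ { refl → i≢j refl }))
        vanish : ∀ S → wedges reducedIncidence S * wedges (rootChain ∘ suc) S ≡ 0ℤ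
        vanish S with ∣ S ∣ ℕ.≟ p | any? (λ k → (k ∈? S) ×-dec ¬? (k ∈? T))
        ... | no ∣S∣≢p | _ = cong (_* wedges (rootChain ∘ suc) S) (wedges-degree reducedIncidence S ∣S∣≢p)
        ... | yes _ | yes (k , k∈S , k∉T) =
          trans (cong (wedges reducedIncidence S *_)
                      (wedges-support (rootChain ∘ suc) (λ i → chain-support G (connected zero (suc i)) k∉T) S k∈S))
                (ℤ.*-zeroʳ (wedges reducedIncidence S))
        ... | yes ∣S∣≡p | no S⊈T
          = cong (_* wedges (rootChain ∘ suc) S) (trans (cong (wedges reducedIncidence) S≡T) T≡0)
          where
          S≡T = ⊆∧∣∣≡⇒≡ (λ {k} k∈S → decidable-stable (k ∈? T) λ k∉T → S⊈T (k , k∈S , k∉T))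
                        (trans ∣S∣≡p (sym spanningTree-size))

    τ≤normSq : + τ G ≤ normSq (const 1ℤ) (wedges reducedIncidence)
    τ≤normSq = count-≤-normSq (isSpanningTree? G) (wedges reducedIncidence) (λ T → spanningTree-coefficient)

    -- Rows extended by a weighted coordinate.

    module _ (x : ℕ) where

      weight : Vector ℤ (suc #edges)
      weight zero    = + x
      weight (suc _) = 1ℤ

      weight-nonneg : ∀ k → 0ℤ ≤ weight k
      weight-nonneg zero    = +≤+ ℕ.z≤n
      weight-nonneg (suc _) = +≤+ ℕ.z≤n

      row : Vertex → Vector ℤ (suc #edges)
      row v zero    = 1ℤ
      row v (suc k) = incidence G v k

      dot-row : ∀ v → dot weight (row v) (row v) ≡ + (x ℕ.+ degree G v)
      dot-row v = cong₂ _+_ (ℤ.*-identityʳ (+ x)) (dot-incidence G v)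

      wedges-row : ∀ S → wedges row (inside ∷ S) ≡ + suc p * wedges reducedIncidence S
      wedges-row S = begin
          wedges row (inside ∷ S)
        ≡⟨ wedges-sum row (inside ∷ S) ⟩
          -- This is the `inside` clause of `wedge` for the sum of all rows, whose first entry is a
          -- sum of ones.
          sum {suc p} (const 1ℤ) * wedges (row ∘ suc) (outside ∷ S)
            - wedge (λ k → sum (λ v → incidence G v k)) (wedges (row ∘ suc) ↾ inside) S
        ≡⟨ cong₂ _-_ (cong₂ _*_ (sum-one (suc p)) (wedges-outside (row ∘ suc) S))
                     (zero-wedge columns (wedges (row ∘ suc) ↾ inside) S) ⟩
          + suc p * wedges reducedIncidence S - 0ℤ
        ≡⟨ ℤ.+-identityʳ _ ⟩
          + suc p * wedges reducedIncidence S
        ∎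
        where
        open ≡-Reasoning
        columns : ∀ k → sum (λ v → incidence G v k) ≡ 0ℤ
        -- The column sum is the coboundary of the constant 1, which computes to zero.
        columns k = trans (sum-cong-≗ (λ v → sym (ℤ.*-identityʳ (incidence G v k)))) (sum-incidence G (const 1ℤ) k)

      τ-bound : x ℕ.* (suc p ℕ.* suc p ℕ.* τ G) ℕ.≤ product (tabulate (λ v → x ℕ.+ degree G v))
      τ-bound = ℤ.drop‿+≤+ (begin
        + (x ℕ.* (suc p ℕ.* suc p ℕ.* τ G))
          ≡⟨ trans (ℤ.pos-* x _) (cong (+ x *_)
                (trans (ℤ.pos-* (suc p ℕ.* suc p) (τ G)) (cong (_* + τ G) (ℤ.pos-* (suc p) (suc p))))) ⟩
        + x * (+ suc p * + suc p * + τ G)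
          ≤⟨ ℤ.*-monoˡ-≤-nonNeg (+ x) (ℤ.*-monoˡ-≤-nonNeg (+ suc p * + suc p) τ≤normSq) ⟩
        + x * (+ suc p * + suc p * normSq (const 1ℤ) (wedges reducedIncidence))
          ≡⟨ cong (+ x *_) (normSq-scale (const 1ℤ) (+ suc p) wedges-row) ⟨
        + x * normSq (const 1ℤ) (wedges row ↾ inside)
          -- Only the sets containing the adjoined coordinate are kept; they carry the factor `x` in
          -- the square length.
          ≤⟨ ℤ.i≤j+i _ (normSq (const 1ℤ) (wedges row ↾ outside))
               {{nonNegative (normSq-nonneg (λ _ → +≤+ ℕ.z≤n) (wedges row ↾ outside))}} ⟩
        normSq weight (wedges row)
          ≤⟨ hadamard weight-nonneg row (λ v → x ℕ.+ degree G v) dot-row ⟩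
        + product (tabulate (λ v → x ℕ.+ degree G v)) ∎)
        where open ℤ.≤-Reasoning

-- Sorted degrees and passage to rationals.

product-degreeSequence : ∀ {n} (G : Multigraph n) (f : ℕ → ℕ) →
                         product (map f (degreeSequence G)) ≡ product (tabulate (f ∘ degree G))
product-degreeSequence G f = trans (product-↭ (map⁺ f (sort-↭ ℕ.≤-decTotalOrder (map (degree G) (allFin _)))))
  (cong product (trans (cong (map f) (map-tabulate id (degree G))) (map-tabulate (degree G) f)))

frac-≤ : ∀ a b c .{{_ : ℕ.NonZero c}} → c ℕ.* a ℕ.≤ b → (+ a) ℚ./ 1 ℚ.≤ (+ b) ℚ./ c
frac-≤ a b (suc c) ca≤b = ℚ.toℚᵘ-cancel-≤ (begin
  ℚ.toℚᵘ ((+ a) ℚ./ 1)      ≃⟨ ℚ.toℚᵘ-fromℚᵘ (mkℚᵘ (+ a) 0) ⟩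
  -- Unnormalised fractions avoid reduction to lowest terms. `mkℚᵘ` takes the predecessor of the
  -- denominator, so `0` means 1 and `c` means `suc c`.
  mkℚᵘ (+ a) 0              ≤⟨ *≤* (subst₂ ℤ._≤_
                                     (trans (ℤ.pos-* (suc c) a) (ℤ.*-comm (+ suc c) (+ a))) 
                                     (sym (ℤ.*-identityʳ (+ b))) (ℤ.+≤+ ca≤b)) ⟩
  mkℚᵘ (+ b) c              ≃⟨ ℚ.toℚᵘ-fromℚᵘ (mkℚᵘ (+ b) c) ⟨
  ℚ.toℚᵘ ((+ b) ℚ./ suc c)  ∎)
  where open ℚᵘ.≤-Reasoning

open import Data.Nat using (_+_; _*_; _^_)
open import Data.Rational using (_≤_)

theorem4p2 : ∀ {n : ℕ} (G : Multigraph n) (Δ≥1 : Δ G ≥ 1) →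
    (+ τ G) / 1 ≤ _/_ (+ product (map (λ d → Δ G + d) (degreeSequence G))) (Δ G * n ^ 2) {{denominator≢0 G Δ≥1}}
-- Without vertices there are no pairs, and `Δ G` computes to 0.
theorem4p2 {zero}  G ()
theorem4p2 {suc p} G Δ≥1 = frac-≤ _ _ _ {{denominator≢0 G Δ≥1}} (begin
  -- `suc p ^ 2` unfolds to `suc p * (suc p * 1)`.
  Δ G * suc p ^ 2 * τ G            ≡⟨ cong (λ x → Δ G * (suc p * x) * τ G) (ℕ.*-identityʳ (suc p)) ⟩
  Δ G * (suc p * suc p) * τ G      ≡⟨ ℕ.*-assoc (Δ G) (suc p * suc p) (τ G) ⟩
  Δ G * (suc p * suc p * τ G)      ≤⟨ IncidenceRows.τ-bound G (Δ G) ⟩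
  product (tabulate (λ v → Δ G + degree G v))
    ≡⟨ product-degreeSequence G (λ d → Δ G + d) ⟨
  product (map (λ d → Δ G + d) (degreeSequence G)) ∎)
  where open ℕ.≤-Reasoning
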